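{- The strategy $\texttt{GreedyCheater}$ is not $c$-competitive in terms of $W$. That is, there do not exist real constants $c>0$ and $b$ such that $$c\cdot W_L(M,\Sigma,\texttt{GreedyCheater})+b\;\ge\; W_L(M,\Sigma,OPT_L)$$ holds for every language $L$ and every situation $(M,\Sigma)$ for $L$.
   Context: A language $L$ here is a finite set of words of a common length $k$ over a finite alphabet. Let $\bot$ be a symbol not in any alphabet ("not yet revealed"). A mask is a word $M$ of length $k$ over the alphabet extended with $\bot$; write $B_M=\{j: M_j=\bot\}$. For words $a,b$ of length $k$, $a\preceq b$ means that for every $j$, $a_j=\bot$ or $a_j=b_j$. $a\oplus b$ is obtained from $a$ by replacing each $\bot$ of $a$ by the character of $b$ at the same position. For a symbol $s$ and $B\subseteq\{1,\dots,k\}$, $s^B$ is the word of length $k$ with $s$ at the positions in $B$ and $\bot$ elsewhere. For a mask $M$ and a finite alphabet $\Sigma$ (the set of symbols not yet guessed), the words consistent with $(M,\Sigma)$ are $$C(L,M,\Sigma)=\{w\in L:\ M\preceq w \text{ and } w_j\in\Sigma\text{ for all } j\in B_M\}.$$ A situation for $L$ is a pair $(M,\Sigma)$ with $C(L,M,\Sigma)\neq\varnothing$. A setter strategy $A$ maps each language $L$, situation $(M,\Sigma)$ for $L$ and guess $s\in\Sigma$ to a new mask $A_L(M,\Sigma,s)=M\oplus s^B$ for some (possibly empty) $B\subseteq B_M$ such that $C(L,M\oplus s^B,\Sigma\setminus\{s\})\ne\varnothing$. The answer is a failed guess for the guesser if $A_L(M,\Sigma,s)=M$. $W_L(M,\Sigma,A)$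 is the minimum number of failed guesses a guesser must make to reveal a full word against $A$ from situation $(M,\Sigma)$. Inductively: $W_L(M,\Sigma,A)=0$ if $M\in L$, and otherwise $$W_L(M,\Sigma,A)=\min_{s\in\Sigma}\Big\{W_L\big(A_L(M,\Sigma,s),\Sigma\setminus\{s\},A\big)+\llbracket A_L(M,\Sigma,s)=M\rrbracket\Big\},$$ where $\llbracket P\rrbracket$ is $1$ if $P$ is true and $0$ otherwise. $OPT_L$ is a setter strategy for which $W_L(M,\Sigma,OPT_L)$ is maximum among all setter strategies, for every situation $(M,\Sigma)$. $\texttt{GreedyCheater}$ is the setter strategy that, in situation $(M,\Sigma)$ on guess $s$, goes through all subsets $B\subseteq B_M$ in some fixed order and answers with the first mask $M\oplus s^B$ maximizing the number $|C(L,M\oplus s^B,\Sigma\setminus\{s\})|$ of words of $L$ that remain consistent with the answer. -}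

module Defs where

open import Algebra.Bundles using (CommutativeMonoid)
import Algebra.Properties.CommutativeSemigroup as CommutativeSemigroup
open import Data.Bool.Base using (true; false; if_then_else_)
open import Data.Fin.Base using (Fin; zero; suc)
open import Data.Fin.Properties using (all?) renaming (_≟_ to _≟ᶠ_)
open import Data.Fin.Subset using (Subset; inside; outside; _∈_; _⊆_; _-_; ∣_∣)
open import Data.Fin.Subset.Properties using (_∈?_; x∈p∧x≢y⇒x∈p-y; x∈p⇒∣p-x∣<∣p∣)
import Data.Integer.Base as ℤ
open import Data.List.Base as List using (List; []; _∷_; filter; length)
import Data.List.Extrema.Nat as Extrema
import Data.List.Membership.DecPropositional as DecMembership
import Data.List.Membership.Propositional as ListMembership
open import Data.List.Membership.Propositional.Properties using (∈-filter⁺; ∈-filter⁻; ∈-length)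
open import Data.List.NonEmpty.Base using (List⁺; toList; head; tail)
open import Data.List.Relation.Unary.Any using (here; there)
open import Data.List.Relation.Unary.Unique.Propositional using (Unique)
open import Data.Maybe.Base using (Maybe; just; nothing; is-nothing; when; _<∣>_)
open import Data.Maybe.Properties using () renaming (≡-dec to ≡-decᴹ)
open import Data.Nat.Base as ℕ using (ℕ; _⊔_)
import Data.Nat.Properties as ℕ
open import Data.Nat.Induction using (<-wellFounded)
open import Data.Product.Base using (∃; ∃-syntax; _×_; _,_; proj₁; proj₂)
open import Data.Rational.Base as ℚ using (ℚ; 0ℚ; 1ℚ; ½)
import Data.Rational.Properties as ℚ
open import Data.Sum.Base using (_⊎_; inj₁; inj₂)
open import Data.Vec.Base as Vec using (Vec; []; _∷_; here; there; lookup; zipWith; tabulate)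
open import Data.Vec.Properties using (lookup-map; lookup-zipWith; lookup∘tabulate; lookup⇒[]=; []=⇒lookup) renaming (≡-dec to ≡-decⱽ)
open import Function.Base using (_∘_)
open import Function.Bundles using (_⇔_; module Equivalence)
open import Induction.WellFounded using (Acc; acc)
open import Relation.Binary.PropositionalEquality using (_≡_; _≢_; refl; sym; trans; cong; cong₂; subst; module ≡-Reasoning)
open import Relation.Nullary using (Dec; yes; no; does; ofʸ; ofⁿ; contradiction)
open import Relation.Nullary.Decidable using (_×-dec_; _⊎-dec_; _→-dec_)

open ListMembership using () renaming (_∈_ to _∈ˡ_)

private variable
  n k : ℕ

-- Reals are Cauchy sequences of rationals; equality would be _≤ᴿ_ in both
-- directions, but only the order is needed.

record ℝ : Set where
  field
    seq    : ℕ → ℚ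
    cauchy : ∀ ε → 0ℚ ℚ.< ε →
             ∃[ N ] ∀ i j → N ℕ.≤ i → N ℕ.≤ j → ℚ.∣ seq i ℚ.- seq j ∣ ℚ.< ε

open ℝ public

infix  4 _≤ᴿ_ _<ᴿ_
infixl 6 _+ᴿ_
infixl 7 _*ᴿ_

_≤ᴿ_ : ℝ → ℝ → Set
x ≤ᴿ y = ∀ ε → 0ℚ ℚ.< ε → ∃[ N ] ∀ i → N ℕ.≤ i → seq x i ℚ.≤ seq y i ℚ.+ ε

_<ᴿ_ : ℝ → ℝ → Set
x <ᴿ y = ∃[ ε ] 0ℚ ℚ.< ε × (∃[ N ] ∀ i → N ℕ.≤ i → seq x i ℚ.+ ε ℚ.≤ seq y i)

fromℚ : ℚ → ℝ
fromℚ q .seq _ = q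
fromℚ q .cauchy ε 0<ε = 0 , λ _ _ _ _ → subst (λ p → ℚ.∣ p ∣ ℚ.< ε) (sym (ℚ.+-inverseʳ q)) 0<ε

fromℕ : ℕ → ℝ
fromℕ m = fromℚ (ℤ.+ m ℚ./ 1)

0ᴿ : ℝ
0ᴿ = fromℚ 0ℚ

private
  -‿cancel : ∀ a c → (a ℚ.- c) ℚ.+ c ≡ a
  -‿cancel a c = trans (ℚ.+-assoc a (ℚ.- c) c)
                (trans (cong (a ℚ.+_) (ℚ.+-inverseˡ c)) (ℚ.+-identityʳ a))

  +-‿interchange : ∀ a b c d → (a ℚ.+ b) ℚ.- (c ℚ.+ d) ≡ (a ℚ.- c) ℚ.+ (b ℚ.- d)
  +-‿interchange a b c d =
    trans (cong (a ℚ.+ b ℚ.+_) (ℚ.neg-distrib-+ c d)) (interchange a b (ℚ.- c) (ℚ.- d))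
    where open CommutativeSemigroup (CommutativeMonoid.commutativeSemigroup ℚ.+-0-commutativeMonoid)

  *-distribˡ-‿ : ∀ a b d → a ℚ.* (b ℚ.- d) ≡ a ℚ.* b ℚ.- a ℚ.* d
  *-distribˡ-‿ a b d =
    trans (ℚ.*-distribˡ-+ a b (ℚ.- d)) (cong (a ℚ.* b ℚ.+_) (sym (ℚ.neg-distribʳ-* a d)))

  *-‿split : ∀ a b c d → a ℚ.* b ℚ.- c ℚ.* d ≡ a ℚ.* (b ℚ.- d) ℚ.+ d ℚ.* (a ℚ.- c)
  *-‿split a b c d = sym (begin
    a ℚ.* (b ℚ.- d) ℚ.+ d ℚ.* (a ℚ.- c)
      ≡⟨ cong₂ ℚ._+_ (*-distribˡ-‿ a b d) (*-distribˡ-‿ d a c) ⟩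
    (a ℚ.* b ℚ.- a ℚ.* d) ℚ.+ (d ℚ.* a ℚ.- d ℚ.* c)
      ≡⟨ cong₂ (λ p q → (a ℚ.* b ℚ.- a ℚ.* d) ℚ.+ (p ℚ.- q)) (ℚ.*-comm d a) (ℚ.*-comm d c) ⟩
    (a ℚ.* b ℚ.- a ℚ.* d) ℚ.+ (a ℚ.* d ℚ.- c ℚ.* d)
      ≡⟨ ℚ.+-assoc (a ℚ.* b ℚ.- a ℚ.* d) (a ℚ.* d) (ℚ.- (c ℚ.* d)) ⟨
    (a ℚ.* b ℚ.- a ℚ.* d) ℚ.+ a ℚ.* d ℚ.- c ℚ.* d
      ≡⟨ cong (ℚ._- c ℚ.* d) (-‿cancel (a ℚ.* b) (a ℚ.* d)) ⟩
    a ℚ.* b ℚ.- c ℚ.* d ∎)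
    where open ≡-Reasoning

  half-pos : ∀ {ε} → 0ℚ ℚ.< ε → 0ℚ ℚ.< ½ ℚ.* ε
  half-pos {ε} 0<ε = subst (ℚ._< ½ ℚ.* ε) (ℚ.*-zeroʳ ½) (ℚ.*-monoʳ-<-pos ½ 0<ε)

  half+half : ∀ ε → ½ ℚ.* ε ℚ.+ ½ ℚ.* ε ≡ ε
  half+half ε = trans (sym (ℚ.*-distribʳ-+ ε ½ ½)) (ℚ.*-identityˡ ε)

  bounded : (x : ℝ) → ∃[ K ] 0ℚ ℚ.< K × (∃[ N ] ∀ i → N ℕ.≤ i → ℚ.∣ seq x i ∣ ℚ.≤ K)
  bounded x with cauchy x 1ℚ (ℚ.positive⁻¹ 1ℚ)
  ... | N , close = 1ℚ ℚ.+ ℚ.∣ c ∣ , ℚ.+-mono-<-≤ (ℚ.positive⁻¹ 1ℚ) (ℚ.0≤∣p∣ c) , N , bound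
    where
    c = seq x N
    open ℚ.≤-Reasoning
    bound : ∀ i → N ℕ.≤ i → ℚ.∣ seq x i ∣ ℚ.≤ 1ℚ ℚ.+ ℚ.∣ c ∣
    bound i N≤i = begin
      ℚ.∣ a ∣                    ≡⟨ cong ℚ.∣_∣ (sym (-‿cancel a c)) ⟩
      ℚ.∣ (a ℚ.- c) ℚ.+ c ∣      ≤⟨ ℚ.∣p+q∣≤∣p∣+∣q∣ (a ℚ.- c) c ⟩
      ℚ.∣ a ℚ.- c ∣ ℚ.+ ℚ.∣ c ∣  ≤⟨ ℚ.+-monoˡ-≤ ℚ.∣ c ∣ (ℚ.<⇒≤ (close i N N≤i ℕ.≤-refl)) ⟩
      1ℚ ℚ.+ ℚ.∣ c ∣             ∎
      where
      a = seq x i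

  -- For K > 0 and ε > 0, some δ > 0 has K * δ = ε / 2.
  shrink : ∀ K ε → 0ℚ ℚ.< K → 0ℚ ℚ.< ε → ∃[ δ ] 0ℚ ℚ.< δ × K ℚ.* δ ≡ ½ ℚ.* ε
  shrink K ε 0<K 0<ε = ℚ.1/ K ℚ.* (½ ℚ.* ε) , 0<δ , Kδ
    where
    instance
      K-pos : ℚ.Positive K
      K-pos = ℚ.positive 0<K
      K-nonZero : ℚ.NonZero K
      K-nonZero = ℚ.pos⇒nonZero K
      1/K-pos : ℚ.Positive (ℚ.1/ K)
      1/K-pos = ℚ.1/pos⇒pos K
    0<δ : 0ℚ ℚ.< ℚ.1/ K ℚ.* (½ ℚ.* ε)
    0<δ = subst (ℚ._< ℚ.1/ K ℚ.* (½ ℚ.* ε)) (ℚ.*-zeroʳ (ℚ.1/ K))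
                (ℚ.*-monoʳ-<-pos (ℚ.1/ K) (half-pos 0<ε))
    Kδ : K ℚ.* (ℚ.1/ K ℚ.* (½ ℚ.* ε)) ≡ ½ ℚ.* ε
    Kδ = trans (sym (ℚ.*-assoc K (ℚ.1/ K) (½ ℚ.* ε)))
        (trans (cong (ℚ._* (½ ℚ.* ε)) (ℚ.*-inverseʳ K)) (ℚ.*-identityˡ (½ ℚ.* ε)))

  abs-*-≤ : ∀ {p q K δ} → ℚ.∣ p ∣ ℚ.≤ K → ℚ.∣ q ∣ ℚ.≤ δ → ℚ.∣ p ℚ.* q ∣ ℚ.≤ K ℚ.* δ
  abs-*-≤ {p} {q} {K} {δ} p≤K q≤δ = begin
    ℚ.∣ p ℚ.* q ∣          ≡⟨ ℚ.∣p*q∣≡∣p∣*∣q∣ p q ⟩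
    ℚ.∣ p ∣ ℚ.* ℚ.∣ q ∣    ≤⟨ ℚ.*-monoʳ-≤-nonNeg ℚ.∣ q ∣ {{ℚ.∣-∣-nonNeg q}} p≤K ⟩
    K ℚ.* ℚ.∣ q ∣          ≤⟨ ℚ.*-monoˡ-≤-nonNeg K {{ℚ.nonNegative (ℚ.≤-trans (ℚ.0≤∣p∣ p) p≤K)}} q≤δ ⟩
    K ℚ.* δ                ∎
    where open ℚ.≤-Reasoning

_+ᴿ_ : ℝ → ℝ → ℝ
(x +ᴿ y) .seq i = seq x i ℚ.+ seq y i
(x +ᴿ y) .cauchy ε 0<ε
  with cauchy x (½ ℚ.* ε) (half-pos 0<ε) | cauchy y (½ ℚ.* ε) (half-pos 0<ε)
... | N₁ , close₁ | N₂ , close₂ = N₁ ⊔ N₂ , λ i j N≤i N≤j →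
  let a = seq x i; b = seq y i; c = seq x j; d = seq y j in begin-strict
  ℚ.∣ (a ℚ.+ b) ℚ.- (c ℚ.+ d) ∣
    ≡⟨ cong ℚ.∣_∣ (+-‿interchange a b c d) ⟩
  ℚ.∣ (a ℚ.- c) ℚ.+ (b ℚ.- d) ∣
    ≤⟨ ℚ.∣p+q∣≤∣p∣+∣q∣ (a ℚ.- c) (b ℚ.- d) ⟩
  ℚ.∣ a ℚ.- c ∣ ℚ.+ ℚ.∣ b ℚ.- d ∣
    <⟨ ℚ.+-mono-< (close₁ i j (ℕ.m⊔n≤o⇒m≤o N₁ N₂ N≤i) (ℕ.m⊔n≤o⇒m≤o N₁ N₂ N≤j))
                  (close₂ i j (ℕ.m⊔n≤o⇒n≤o N₁ N₂ N≤i) (ℕ.m⊔n≤o⇒n≤o N₁ N₂ N≤j)) ⟩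
  ½ ℚ.* ε ℚ.+ ½ ℚ.* ε
    ≡⟨ half+half ε ⟩
  ε ∎
  where
  open ℚ.≤-Reasoning

_*ᴿ_ : ℝ → ℝ → ℝ
(x *ᴿ y) .seq i = seq x i ℚ.* seq y i
(x *ᴿ y) .cauchy ε 0<ε
  with bounded x | bounded y
... | K , 0<K , N₁ , bound₁ | L , 0<L , N₂ , bound₂
  with shrink K (½ ℚ.* ε) 0<K (half-pos 0<ε) | shrink L (½ ℚ.* ε) 0<L (half-pos 0<ε)
... | δ , 0<δ , Kδ | γ , 0<γ , Lγ
  with cauchy y δ 0<δ | cauchy x γ 0<γ
... | N₃ , close₃ | N₄ , close₄ = N , close
  where
  open ℚ.≤-Reasoning
  N = (N₁ ⊔ N₂) ⊔ (N₃ ⊔ N₄)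
  N₁₂ : ∀ {i} → N ℕ.≤ i → N₁ ⊔ N₂ ℕ.≤ i
  N₁₂ = ℕ.m⊔n≤o⇒m≤o (N₁ ⊔ N₂) (N₃ ⊔ N₄)
  N₃₄ : ∀ {i} → N ℕ.≤ i → N₃ ⊔ N₄ ℕ.≤ i
  N₃₄ = ℕ.m⊔n≤o⇒n≤o (N₁ ⊔ N₂) (N₃ ⊔ N₄)
  ≤N₁ : ∀ {i} → N ℕ.≤ i → N₁ ℕ.≤ i
  ≤N₁ = ℕ.m⊔n≤o⇒m≤o N₁ N₂ ∘ N₁₂
  ≤N₂ : ∀ {i} → N ℕ.≤ i → N₂ ℕ.≤ i
  ≤N₂ = ℕ.m⊔n≤o⇒n≤o N₁ N₂ ∘ N₁₂
  ≤N₃ : ∀ {i} → N ℕ.≤ i → N₃ ℕ.≤ i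
  ≤N₃ = ℕ.m⊔n≤o⇒m≤o N₃ N₄ ∘ N₃₄
  ≤N₄ : ∀ {i} → N ℕ.≤ i → N₄ ℕ.≤ i
  ≤N₄ = ℕ.m⊔n≤o⇒n≤o N₃ N₄ ∘ N₃₄
  close : ∀ i j → N ℕ.≤ i → N ℕ.≤ j →
          ℚ.∣ seq x i ℚ.* seq y i ℚ.- seq x j ℚ.* seq y j ∣ ℚ.< ε
  close i j N≤i N≤j = let a = seq x i; b = seq y i; c = seq x j; d = seq y j in begin-strict
    ℚ.∣ a ℚ.* b ℚ.- c ℚ.* d ∣
      ≡⟨ cong ℚ.∣_∣ (*-‿split a b c d) ⟩
    ℚ.∣ a ℚ.* (b ℚ.- d) ℚ.+ d ℚ.* (a ℚ.- c) ∣
      ≤⟨ ℚ.∣p+q∣≤∣p∣+∣q∣ (a ℚ.* (b ℚ.- d)) (d ℚ.* (a ℚ.- c)) ⟩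
    ℚ.∣ a ℚ.* (b ℚ.- d) ∣ ℚ.+ ℚ.∣ d ℚ.* (a ℚ.- c) ∣
      ≤⟨ ℚ.+-mono-≤
           (abs-*-≤ {p = a} {q = b ℚ.- d} (bound₁ i (≤N₁ N≤i)) (ℚ.<⇒≤ (close₃ i j (≤N₃ N≤i) (≤N₃ N≤j))))
           (abs-*-≤ {p = d} {q = a ℚ.- c} (bound₂ j (≤N₂ N≤j)) (ℚ.<⇒≤ (close₄ i j (≤N₄ N≤i) (≤N₄ N≤j)))) ⟩
    K ℚ.* δ ℚ.+ L ℚ.* γ
      ≡⟨ cong₂ ℚ._+_ Kδ Lγ ⟩
    ½ ℚ.* (½ ℚ.* ε) ℚ.+ ½ ℚ.* (½ ℚ.* ε)
      ≡⟨ half+half (½ ℚ.* ε) ⟩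
    ½ ℚ.* ε
      ≡⟨ ℚ.+-identityʳ (½ ℚ.* ε) ⟨
    ½ ℚ.* ε ℚ.+ 0ℚ
      <⟨ ℚ.+-monoʳ-< (½ ℚ.* ε) (half-pos 0<ε) ⟩
    ½ ℚ.* ε ℚ.+ ½ ℚ.* ε
      ≡⟨ half+half ε ⟩
    ε ∎

-- The alphabet is Fin n, and nothing stands for a position not yet revealed.

Word : ℕ → ℕ → Set
Word n k = Vec (Fin n) k

Mask : ℕ → ℕ → Set
Mask n k = Vec (Maybe (Fin n)) k

record Language (n k : ℕ) : Set where
  field
    words  : List (Word n k)
    unique : Unique words

open Language public

reveal : Word n k → Mask n k
reveal = Vec.map just

blanks : Mask n k → Subset k
blanks = Vec.map is-nothing

infix 4 _≼_

_≼_ : Mask n k → Mask n k → Set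
a ≼ b = ∀ j → lookup a j ≡ nothing ⊎ lookup a j ≡ lookup b j

_≟ᴹ_ : (a b : Mask n k) → Dec (a ≡ b)
_≟ᴹ_ = ≡-decⱽ (≡-decᴹ _≟ᶠ_)

_≼?_ : (a b : Mask n k) → Dec (a ≼ b)
a ≼? b = all? λ j → (lookup a j ≟ᶜ nothing) ⊎-dec (lookup a j ≟ᶜ lookup b j)
  where _≟ᶜ_ = ≡-decᴹ _≟ᶠ_

infixl 6 _⊕_
infix  7 _^_

_⊕_ : Mask n k → Mask n k → Mask n k
_⊕_ = zipWith _<∣>_

_^_ : Fin n → Subset k → Mask n k
s ^ B = Vec.map (λ b → when b s) B

Consistent : Mask n k → Subset n → Word n k → Set
Consistent M Γ w = M ≼ reveal w × (∀ j → j ∈ blanks M → lookup w j ∈ Γ)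

consistent? : (M : Mask n k) (Γ : Subset n) (w : Word n k) → Dec (Consistent M Γ w)
consistent? M Γ w = (M ≼? reveal w) ×-dec all? λ j → (j ∈? blanks M) →-dec (lookup w j ∈? Γ)

C : Language n k → Mask n k → Subset n → List (Word n k)
C L M Γ = filter (consistent? M Γ) (words L)

-- A proof of xs ≢ [] is definitionally irrelevant, so a situation carries
-- no information besides the mask and the set of symbols not yet guessed.
record Situation (L : Language n k) : Set where
  constructor situation
  field
    mask      : Mask n k
    unguessed : Subset n
    possible  : C L mask unguessed ≢ []

open Situation public

record Answer (L : Language n k) (S : Situation L) (s : Fin n) : Set where
  field
    positions : Subset k
    blank     : positions ⊆ blanks (mask S)
    possible′ : C L (mask S ⊕ s ^ positions) (unguessed S - s) ≢ []

  next : Situation L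
  next = situation (mask S ⊕ s ^ positions) (unguessed S - s) possible′

open Answer public

Strategy : Set
Strategy = ∀ {n k} (L : Language n k) (S : Situation L) (s : Fin n) → s ∈ unguessed S → Answer L S s

elements : (p : Subset n) → List (∃ (_∈ p))
elements []            = []
elements (inside  ∷ p) = (zero , here) ∷ List.map (λ (x , x∈p) → suc x , there x∈p) (elements p)
elements (outside ∷ p) = List.map (λ (x , x∈p) → suc x , there x∈p) (elements p)

-- The value at [] is irrelevant: if a situation has no unguessed symbol,
-- its mask has no blank position, hence belongs to the language.
minimum : List ℕ → ℕ
minimum []       = 0
minimum (x ∷ xs) = Extrema.min x xs

revealed? : (L : Language n k) (M : Mask n k) → Dec (M ∈ˡ List.map reveal (words L))
revealed? L M = M ∈ᴹ? List.map reveal (words L)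
  where open DecMembership _≟ᴹ_ renaming (_∈?_ to _∈ᴹ?_)

failed : (M M′ : Mask n k) → ℕ
failed M M′ = if does (M′ ≟ᴹ M) then 1 else 0

W-acc : (L : Language n k) (S : Situation L) → Strategy → Acc ℕ._<_ ∣ unguessed S ∣ → ℕ
W-acc L S A (acc rec) =
  if does (revealed? L (mask S)) then 0 else
  minimum (List.map
    (λ (s , s∈Γ) → let S′ = next (A L S s s∈Γ) in
      W-acc L S′ A (rec (x∈p⇒∣p-x∣<∣p∣ s∈Γ)) ℕ.+ failed (mask S) (mask S′))
    (elements (unguessed S)))

W : (L : Language n k) → Situation L → Strategy → ℕ
W L S A = W-acc L S A (<-wellFounded ∣ unguessed S ∣)

IsOptimal : Language n k → Strategy → Set
IsOptimal L O = ∀ (S : Situation L) (A : Strategy) → W L S A ℕ.≤ W L S O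

-- An order in which to go through the subsets of each set U. Repetitions are
-- harmless, since only the first occurrence of a subset matters.
record SubsetOrder : Set where
  field
    subsets   : (U : Subset k) → List⁺ (Subset k)
    ∈-subsets : (U B : Subset k) → B ∈ˡ toList (subsets U) ⇔ B ⊆ U

open SubsetOrder public

-- Ties are broken in favour of the earliest element.
firstMax : {A : Set} → (A → ℕ) → A → List A → A
firstMax f x []       = x
firstMax f x (y ∷ ys) = if f (firstMax f y ys) ℕ.≤ᵇ f x then x else firstMax f y ys

firstMax-spec : {A : Set} (f : A → ℕ) (x : A) (xs : List A) →
                firstMax f x xs ∈ˡ x ∷ xs × (∀ {y} → y ∈ˡ x ∷ xs → f y ℕ.≤ f (firstMax f x xs))
firstMax-spec f x []       = here refl , λ { (here refl) → ℕ.≤-refl }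
firstMax-spec f x (y ∷ ys)
  with f (firstMax f y ys) ℕ.≤ᵇ f x | ℕ.≤ᵇ-reflects-≤ (f (firstMax f y ys)) (f x)
     | firstMax-spec f y ys
... | true  | ofʸ m≤x | _ , max = here refl , λ
  { (here refl) → ℕ.≤-refl ; (there z∈) → ℕ.≤-trans (max z∈) m≤x }
... | false | ofⁿ m≰x | m∈ , max = there m∈ , λ
  { (here refl) → ℕ.≰⇒≥ m≰x ; (there z∈) → max z∈ }

≢[]⇒∃ : {A : Set} {xs : List A} → xs ≢ [] → ∃ (_∈ˡ xs)
≢[]⇒∃ {xs = []}    ne = contradiction refl ne
≢[]⇒∃ {xs = x ∷ _} _  = x , here refl

0<length⇒≢[] : {A : Set} {xs : List A} → 0 ℕ.< length xs → xs ≢ []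
0<length⇒≢[] () refl

-- The positions that an honest setter with secret word w would reveal.
occurrences : Mask n k → Fin n → Word n k → Subset k
occurrences M s w = tabulate λ j → does ((j ∈? blanks M) ×-dec (lookup w j ≟ᶠ s))

occurrences⊆blanks : (M : Mask n k) (s : Fin n) (w : Word n k) → occurrences M s w ⊆ blanks M
occurrences⊆blanks M s w {j} j∈ with j ∈? blanks M | lookup w j ≟ᶠ s |
  trans (sym (lookup∘tabulate (λ j → does ((j ∈? blanks M) ×-dec (lookup w j ≟ᶠ s))) j)) ([]=⇒lookup j∈)
... | yes j∈M | _ | _  = j∈M
... | no  _   | _ | ()

lookup-blanks : (M : Mask n k) (j : Fin k) → lookup (blanks M) j ≡ is-nothing (lookup M j)
lookup-blanks M j = lookup-map j is-nothing M

nothing⇒blank : (M : Mask n k) (j : Fin k) → lookup M j ≡ nothing → j ∈ blanks M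
nothing⇒blank M j eq = lookup⇒[]= j (blanks M) (trans (lookup-blanks M j) (cong is-nothing eq))

blank⇒nothing : (M : Mask n k) (j : Fin k) → j ∈ blanks M → lookup M j ≡ nothing
blank⇒nothing M j j∈ with lookup M j | trans (sym (lookup-blanks M j)) ([]=⇒lookup j∈)
... | nothing | _  = refl
... | just _  | ()

lookup-⊕ : (M : Mask n k) (s : Fin n) (B : Subset k) (j : Fin k) →
           lookup (M ⊕ s ^ B) j ≡ (lookup M j <∣> when (lookup B j) s)
lookup-⊕ M s B j = trans (lookup-zipWith _<∣>_ j M (s ^ B))
                         (cong (lookup M j <∣>_) (lookup-map j (λ b → when b s) B))

occurrences-consistent : (M : Mask n k) (Γ : Subset n) (s : Fin n) (w : Word n k) →
  Consistent M Γ w → Consistent (M ⊕ s ^ occurrences M s w) (Γ - s) w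
occurrences-consistent M Γ s w (M≼w , w∈Γ) =
  (λ j → proj₁ (at j)) , (λ j j∈ → proj₂ (at j) (blank⇒nothing M′ j j∈))
  where
  M′ = M ⊕ s ^ occurrences M s w
  At : Fin _ → Maybe (Fin _) → Set
  At j m = (m ≡ nothing ⊎ m ≡ lookup (reveal w) j) × (m ≡ nothing → lookup w j ∈ Γ - s)
  lookup-M′ : ∀ j → lookup M′ j ≡
    (lookup M j <∣> when (does ((j ∈? blanks M) ×-dec (lookup w j ≟ᶠ s))) s)
  lookup-M′ j = trans (lookup-⊕ M s (occurrences M s w) j)
    (cong (λ b → lookup M j <∣> when b s) (lookup∘tabulate _ j))
  at′ : ∀ j → At j (lookup M j <∣> when (does ((j ∈? blanks M) ×-dec (lookup w j ≟ᶠ s))) s)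
  at′ j with lookup M j in eq | M≼w j
  ... | just c  | inj₂ c≡w = inj₂ c≡w , λ ()
  ... | nothing | _ with j ∈? blanks M | lookup w j ≟ᶠ s
  ...   | yes _   | yes w≡s = inj₂ (sym (trans (lookup-map j just w) (cong just w≡s))) , λ ()
  ...   | yes j∈M | no  w≢s = inj₁ refl , λ _ → x∈p∧x≢y⇒x∈p-y (w∈Γ j j∈M) w≢s
  ...   | no  j∉M | _       = contradiction (nothing⇒blank M j eq) j∉M
  at : ∀ j → At j (lookup M′ j)
  at j = subst (At j) (sym (lookup-M′ j)) (at′ j)

GreedyCheater : SubsetOrder → Strategy
GreedyCheater order L S s _ = record
  { positions = best
  ; blank     = best⊆U
  ; possible′ = 0<length⇒≢[] (ℕ.<-≤-trans (∈-length w∈C′) (proj₂ spec honest∈))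
  }
  where
  M = mask S
  Γ = unguessed S
  U = blanks M
  candidates = subsets order U
  count : Subset _ → ℕ
  count B = length (C L (M ⊕ s ^ B) (Γ - s))
  best = firstMax count (head candidates) (tail candidates)
  spec = firstMax-spec count (head candidates) (tail candidates)
  best⊆U : best ⊆ U
  best⊆U = Equivalence.to (∈-subsets order U best) (proj₁ spec)
  nonempty = ≢[]⇒∃ (possible S)
  w = proj₁ nonempty
  w∈C = ∈-filter⁻ (consistent? M Γ) {xs = words L} (proj₂ nonempty)
  honest = occurrences M s w
  honest∈ = Equivalence.from (∈-subsets order U honest) (occurrences⊆blanks M s w)
  w∈C′ = ∈-filter⁺ (consistent? (M ⊕ s ^ honest) (Γ - s)) (proj₁ w∈C)
           (occurrences-consistent M Γ s w (proj₂ w∈C))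

-- Fix letters a, p, q and m further letters x.  The language consists of the m + 1
-- easy words a q…q p q…q and of the m hard words x…x, all of length m + 2, and
-- nothing is revealed at the start.  When a is guessed, revealing the first
-- position keeps all easy words, while any answer that leaves it blank loses every
-- easy one; so GreedyCheater reveals it, and guessing p and q completes the word
-- after at most three guesses.  A setter that refuses every guess as long as some
-- word remains consistent keeps all hard words with unguessed letters, so that
-- every hard letter but the last costs a failed guess.  An optimal strategy, which
-- does at least as well, exists by backward induction.

module Submission where

open import Data.Bool.Base using (if_then_else_)
open import Data.Fin.Base using (Fin; zero; suc; _↑ʳ_)
open import Data.Fin.Properties using (suc-injective; _≟_)
open import Data.Fin.Subset
  using (Subset; inside; outside; _∈_; _∉_; _⊆_; _-_; ∣_∣; ⊥; ⊤; Nonempty; ⁅_⁆)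
open import Data.Fin.Subset.Properties
  using (p─⊥≡p; p─q⊆p; ∈⊤; ∉⊥; ∣⊤∣≡n; x∈p∧x≢y⇒x∈p-y; x∈p⇒∣p-x∣<∣p∣)
import Data.Integer.Base as ℤ
import Data.Integer.Properties as ℤ
open import Data.List.Base as List using (List; []; _∷_; _++_; filter; length)
import Data.List.Extrema.Nat as Extrema
open import Data.List.Membership.Propositional
  using (mapWith∈) renaming (_∈_ to _∈ˡ_; _∉_ to _∉ˡ_)
open import Data.List.Membership.Propositional.Properties
  using (∈-filter⁺; ∈-filter⁻; ∈-map⁺; ∈-map⁻; ∈-++⁺ʳ; ∈-++⁻; ∈-tabulate⁺; ∈-tabulate⁻)
open import Data.List.NonEmpty.Base using (toList; head; tail)
import Data.List.Properties as List
import Data.List.Relation.Unary.All as All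
import Data.List.Relation.Unary.All.Properties as All
open import Data.List.Relation.Unary.Any using (here; there)
open import Data.List.Relation.Unary.Any.Properties using (mapWith∈⁺)
import Data.List.Relation.Unary.Unique.Propositional.Properties as Unique
open import Data.Maybe.Base using (just; nothing; when; _<∣>_)
open import Data.Nat.Base as ℕ using (ℕ; suc; _+_; _*_; _∸_; _⊔_; _≤_; _<_; z≤n; s≤s; s≤s⁻¹)
open import Data.Nat.Coprimality using (1-coprimeTo) renaming (sym to coprime-sym)
open import Data.Nat.Induction using (<-wellFounded)
open import Data.Nat.Properties as ℕ using (≤-refl; ≤-trans; ≤-reflexive)
open import Data.Product.Base using (∃; ∃-syntax; _×_; _,_; proj₁; proj₂)
open import Data.Rational.Base as ℚ using (ℚ; 0ℚ; 1ℚ; mkℚ; *≤*)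
import Data.Rational.Properties as ℚ
open import Data.Sum.Base using (_⊎_; inj₁; inj₂; [_,_]′)
open import Data.Vec.Base using (Vec; []; _∷_; here; there; lookup; replicate; _[_]≔_)
open import Data.Vec.Properties
  using (lookup-replicate; lookup∘update; lookup∘update′; tabulate∘lookup; tabulate-cong)
  renaming (≡-dec to ≡-decⱽ)
open import Function.Base using (id)
open import Function.Bundles using (module Equivalence)
open import Induction.WellFounded using (Acc; acc)
open import Relation.Binary.PropositionalEquality
  using (_≡_; _≢_; refl; sym; trans; cong; cong₂; subst; module ≡-Reasoning)
open import Relation.Nullary using (¬_; Dec; yes; no; does; contradiction; ¬?)
open import Defs

private variable
  n k : ℕ

-- Minima of lists, and independence of `W-acc` from the accessibility proof.

minimum-≤ : ∀ {x} {xs : List ℕ} → x ∈ˡ xs → minimum xs ≤ x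
minimum-≤ {xs = y ∷ ys} (here refl) = Extrema.min≤⊤ y ys
minimum-≤ {xs = y ∷ ys} (there x∈)  = All.lookup (Extrema.min≤xs y ys) x∈

minimum-glb : ∀ {v} {xs : List ℕ} → xs ≢ [] → (∀ {x} → x ∈ˡ xs → v ≤ x) → v ≤ minimum xs
minimum-glb {xs = []}    ne _ = contradiction refl ne
minimum-glb {xs = _ ∷ _} _  h = Extrema.v≤min⁺ (h (here refl)) (All.tabulate (λ x∈ → h (there x∈)))

minimum-map-mono : {X : Set} {f g : X → ℕ} → (∀ x → f x ≤ g x) →
                   ∀ xs → minimum (List.map f xs) ≤ minimum (List.map g xs)
minimum-map-mono f≤g []       = z≤n
minimum-map-mono {f = f} {g} f≤g xs@(_ ∷ _) = minimum-glb {xs = List.map g xs} (λ ()) λ v∈ →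
  let x , x∈ , v≡ = ∈-map⁻ g v∈ in
  ≤-trans (minimum-≤ (∈-map⁺ f x∈)) (≤-trans (f≤g x) (≤-reflexive (sym v≡)))

∈-elements : ∀ {p : Subset n} {x} (x∈p : x ∈ p) → (x , x∈p) ∈ˡ elements p
∈-elements {p = inside  ∷ p} here        = here refl
∈-elements {p = inside  ∷ p} (there x∈p) = there (∈-map⁺ _ (∈-elements x∈p))
∈-elements {p = outside ∷ p} (there x∈p) = ∈-map⁺ _ (∈-elements x∈p)

if-mono : {P : Set} (d : Dec P) {x y z : ℕ} → x ≤ y → (if does d then z else x) ≤ (if does d then z else y)
if-mono (yes _) _   = ≤-refl
if-mono (no  _) x≤y = x≤y

-- The proofs reached by recursion need not agree definitionally with the canonical one. One
-- inequality suffices, since `a` and `a′` may be exchanged.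
W-irrelevant : (L : Language n k) (S : Situation L) (A : Strategy) (a a′ : Acc _<_ ∣ unguessed S ∣) →
               W-acc L S A a ≤ W-acc L S A a′
W-irrelevant L S A (acc rec) (acc rec′) = if-mono (revealed? L (mask S))
  (minimum-map-mono (λ (s , s∈Γ) → ℕ.+-monoˡ-≤ _
      (W-irrelevant L (next (A L S s s∈Γ)) A (rec (x∈p⇒∣p-x∣<∣p∣ s∈Γ)) (rec′ (x∈p⇒∣p-x∣<∣p∣ s∈Γ))))
    (elements (unguessed S)))

-- An optimal strategy by backward induction.

module Optimal (order : SubsetOrder) where

  module _ {L : Language n k} {S : Situation L} {s : Fin n} where

    Possible : Subset k → Set
    Possible B = C L (mask S ⊕ s ^ B) (unguessed S - s) ≢ []

    possible? : (B : Subset k) → Dec (Possible B)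
    possible? B = ¬? (List.≡-dec (≡-decⱽ _≟_) _ [])

    candidates : List (Subset k)
    candidates = filter possible? (toList (subsets order (blanks (mask S))))

    toAnswer : ∀ {B} → B ∈ˡ candidates → Answer L S s
    toAnswer {B} B∈ = let B∈′ , p = ∈-filter⁻ possible? B∈ in record
      { positions = B
      ; blank     = Equivalence.to (∈-subsets order (blanks (mask S)) B) B∈′
      ; possible′ = p
      }

    -- `firstMax` asks for a first element; the answer of `GreedyCheater` is a legal one, so no
    -- separate nonemptiness proof is required.
    best : s ∈ unguessed S → (Answer L S s → ℕ) → Answer L S s
    best s∈Γ f = firstMax f (GreedyCheater order L S s s∈Γ) (mapWith∈ candidates toAnswer)

    -- Answers with the same positions may differ in their proof of blank.
    Extensional : (Answer L S s → ℕ) → Set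
    Extensional f = ∀ a a′ → positions a ≡ positions a′ → f a ≡ f a′

    -- The list contains an answer with the same positions as `a`, and `Extensional` transfers the
    -- bound from it to `a`.
    best-max : (s∈Γ : s ∈ unguessed S) (f : Answer L S s → ℕ) → Extensional f →
               ∀ a → f a ≤ f (best s∈Γ f)
    best-max s∈Γ f ext a = ≤-trans (≤-reflexive (ext a (toAnswer a∈) refl))
      (proj₂ (firstMax-spec f (GreedyCheater order L S s s∈Γ) (mapWith∈ candidates toAnswer))
        (there (mapWith∈⁺ toAnswer (positions a , a∈ , refl))))
      where
      a∈ : positions a ∈ˡ candidates
      a∈ = ∈-filter⁺ possible? (Equivalence.from (∈-subsets order _ _) (blank a)) (possible′ a)

  -- The minimax value of the game: the guesser minimises over symbols, the setter maximises `score`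
  -- over legal answers.
  value : (L : Language n k) (S : Situation L) → Acc _<_ ∣ unguessed S ∣ → ℕ
  score : (L : Language n k) (S : Situation L) (s : Fin n) →
          Acc _<_ ∣ unguessed S - s ∣ → Answer L S s → ℕ

  value L S (acc rec) =
    if does (revealed? L (mask S)) then 0 else
    minimum (List.map
      (λ (s , s∈Γ) → let f = score L S s (rec (x∈p⇒∣p-x∣<∣p∣ s∈Γ)) in f (best s∈Γ f))
      (elements (unguessed S)))

  score L S s a x = value L (next x) a + failed (mask S) (mask (next x))

  best-score : (L : Language n k) (S : Situation L) (s : Fin n) (s∈Γ : s ∈ unguessed S)
    (a : Acc _<_ ∣ unguessed S - s ∣) (x : Answer L S s) →
    score L S s a x ≤ score L S s a (best s∈Γ (score L S s a))
  -- `score` sees an answer only through `next`, which ignores `blank` and in which `possible′` is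
  -- definitionally irrelevant; hence `refl` once the positions agree.
  best-score L S s s∈Γ a = best-max s∈Γ (score L S s a) (λ { _ _ refl → refl })

  -- A strategy receives no accessibility proof, so the canonical one is used.
  opt : Strategy
  opt L S s s∈Γ = best s∈Γ (score L S s (<-wellFounded ∣ unguessed S - s ∣))

  -- Here the accessibility proof also influences which answer `best` picks. The pick `x` made with
  -- `a` scores at least as much with `a′` by induction, and `best-score` then passes to the pick
  -- made with `a′`.
  value-irrelevant : (L : Language n k) (S : Situation L) (a a′ : Acc _<_ ∣ unguessed S ∣) →
                     value L S a ≤ value L S a′
  value-irrelevant L S (acc rec) (acc rec′) = if-mono (revealed? L (mask S))
    (minimum-map-mono (λ (s , s∈Γ) →
      let a  = rec  (x∈p⇒∣p-x∣<∣p∣ s∈Γ)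
          a′ = rec′ (x∈p⇒∣p-x∣<∣p∣ s∈Γ)
          x  = best s∈Γ (score L S s a)
      in ≤-trans (ℕ.+-monoˡ-≤ (failed (mask S) (mask (next x))) (value-irrelevant L (next x) a a′))
                 (best-score L S s s∈Γ a′ x))
      (elements (unguessed S)))

  -- The answer of `A` competes in the maximum that defines `value`, and induction covers the rest
  -- of the game.
  W≤value : (L : Language n k) (S : Situation L) (A : Strategy) (a a′ : Acc _<_ ∣ unguessed S ∣) →
            W-acc L S A a ≤ value L S a′
  W≤value L S A (acc rec) (acc rec′) = if-mono (revealed? L (mask S))
    (minimum-map-mono (λ (s , s∈Γ) →
      let x  = A L S s s∈Γ
          a  = rec  (x∈p⇒∣p-x∣<∣p∣ s∈Γ)
          a′ = rec′ (x∈p⇒∣p-x∣<∣p∣ s∈Γ)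
      in ≤-trans (ℕ.+-monoˡ-≤ (failed (mask S) (mask (next x))) (W≤value L (next x) A a a′))
                 (best-score L S s s∈Γ a′ x))
      (elements (unguessed S)))

  -- Three accessibility proofs meet: `a` in `value`, `b` in the choice made by `opt`, `a′` in
  -- `W-acc`. The pick `y` for `a` is rescored with `b`, beaten there by the pick `x` of `opt`, and
  -- induction leads from `b` to `a′`.
  value≤W : (L : Language n k) (S : Situation L) (a a′ : Acc _<_ ∣ unguessed S ∣) →
            value L S a ≤ W-acc L S opt a′
  value≤W L S (acc rec) (acc rec′) = if-mono (revealed? L (mask S))
    (minimum-map-mono (λ (s , s∈Γ) →
      let x  = opt L S s s∈Γ
          a  = rec  (x∈p⇒∣p-x∣<∣p∣ s∈Γ)
          a′ = rec′ (x∈p⇒∣p-x∣<∣p∣ s∈Γ)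
          b  = <-wellFounded ∣ unguessed S - s ∣
          y  = best s∈Γ (score L S s a)
      in ≤-trans (ℕ.+-monoˡ-≤ (failed (mask S) (mask (next y))) (value-irrelevant L (next y) a b))
        (≤-trans (best-score L S s s∈Γ b y)
                 (ℕ.+-monoˡ-≤ (failed (mask S) (mask (next x))) (value≤W L (next x) b a′))))
      (elements (unguessed S)))

  opt-optimal : (L : Language n k) → IsOptimal L opt
  opt-optimal L S A = ≤-trans (W≤value L S A a a) (value≤W L S a a)
    where
    a = <-wellFounded ∣ unguessed S ∣

-- Sizes of subsets and elementary facts about masks.

∣x∷p∣≤1+∣p∣ : ∀ x (p : Subset n) → ∣ x ∷ p ∣ ≤ suc ∣ p ∣
∣x∷p∣≤1+∣p∣ outside p = ℕ.n≤1+n ∣ p ∣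
∣x∷p∣≤1+∣p∣ inside  p = ≤-refl

∣p∣≤1+∣p-x∣ : (p : Subset n) (x : Fin n) → ∣ p ∣ ≤ suc ∣ p - x ∣
∣p∣≤1+∣p-x∣ (b ∷ p) zero =
  ≤-trans (∣x∷p∣≤1+∣p∣ b p) (s≤s (≤-reflexive (cong ∣_∣ (sym (p─⊥≡p p)))))
∣p∣≤1+∣p-x∣ (inside  ∷ p) (suc x) = s≤s (∣p∣≤1+∣p-x∣ p x)
∣p∣≤1+∣p-x∣ (outside ∷ p) (suc x) = ∣p∣≤1+∣p-x∣ p x

x∉p-x : (p : Subset n) (x : Fin n) → x ∉ p - x
x∉p-x (inside  ∷ p) zero ()
x∉p-x (outside ∷ p) zero ()
x∉p-x (_ ∷ p) (suc x) (there x∈) = x∉p-x p x x∈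

0<∣p∣⇒Nonempty : (p : Subset n) → 0 < ∣ p ∣ → Nonempty p
0<∣p∣⇒Nonempty (inside  ∷ p) _ = zero , here
0<∣p∣⇒Nonempty (outside ∷ p) 0<∣p∣ = let x , x∈p = 0<∣p∣⇒Nonempty p 0<∣p∣ in suc x , there x∈p

⊕-^⊥ : (M : Mask n k) (s : Fin n) → M ⊕ s ^ ⊥ ≡ M
⊕-^⊥ []            s = refl
⊕-^⊥ (just x  ∷ M) s = cong (just x ∷_) (⊕-^⊥ M s)
⊕-^⊥ (nothing ∷ M) s = cong (nothing ∷_) (⊕-^⊥ M s)

lookup-⊕-just : (M : Mask n k) (s : Fin n) (B : Subset k) (j : Fin k) {x : Fin n} →
                lookup M j ≡ just x → lookup (M ⊕ s ^ B) j ≡ just x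
lookup-⊕-just M s B j {x} eq = trans (lookup-⊕ M s B j) (cong (_<∣> when (lookup B j) s) eq)

failed≤1 : (M M′ : Mask n k) → failed M M′ ≤ 1
failed≤1 M M′ with M′ ≟ᴹ M
... | yes _ = ≤-refl
... | no  _ = z≤n

failed-≡ : {M M′ : Mask n k} → M′ ≡ M → failed M M′ ≡ 1
failed-≡ {M = M} {M′} M′≡M with M′ ≟ᴹ M
... | yes _   = refl
... | no  neq = contradiction M′≡M neq

-- Bounds on `W` from a single guess.

cost : (L : Language n k) (S : Situation L) (A : Strategy) →
       (∀ {y} → y < ∣ unguessed S ∣ → Acc _<_ y) → ∃ (_∈ unguessed S) → ℕ
cost L S A rec (s , s∈Γ) = let S′ = next (A L S s s∈Γ) in
  W-acc L S′ A (rec (x∈p⇒∣p-x∣<∣p∣ s∈Γ)) + failed (mask S) (mask S′)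

-- The guesser is free to guess `s`, and one guess costs at most one failure.
W-acc-guess : (L : Language n k) (S : Situation L) (A : Strategy) {s : Fin n} (s∈Γ : s ∈ unguessed S)
  (a : Acc _<_ ∣ unguessed S ∣) (a′ : Acc _<_ ∣ unguessed S - s ∣) →
  W-acc L S A a ≤ suc (W-acc L (next (A L S s s∈Γ)) A a′)
W-acc-guess L S A {s} s∈Γ (acc rec) a′ with revealed? L (mask S)
... | yes _ = z≤n
... | no  _ = ≤-trans (minimum-≤ (∈-map⁺ (cost L S A rec) (∈-elements s∈Γ))) (begin
  cost L S A rec (s , s∈Γ)
    ≤⟨ ℕ.+-mono-≤ (W-irrelevant L S′ A (rec (x∈p⇒∣p-x∣<∣p∣ s∈Γ)) a′) (failed≤1 (mask S) (mask S′)) ⟩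
  W-acc L S′ A a′ + 1
    ≡⟨ ℕ.+-comm _ 1 ⟩
  suc (W-acc L S′ A a′) ∎)
  where
  open ℕ.≤-Reasoning
  S′ = next (A L S s s∈Γ)

-- An unguessed symbol makes the list of costs nonempty, which excludes the default value 0 of
-- `minimum`.
W-acc-glb : (L : Language n k) (S : Situation L) (A : Strategy)
  (rec : ∀ {y} → y < ∣ unguessed S ∣ → Acc _<_ y) {v : ℕ} →
  mask S ∉ˡ List.map reveal (words L) → Nonempty (unguessed S) →
  (∀ s s∈Γ → v ≤ cost L S A rec (s , s∈Γ)) → v ≤ W-acc L S A (acc rec)
W-acc-glb L S A rec {v} ¬r (s₀ , s₀∈Γ) v≤ with revealed? L (mask S)
... | yes r = contradiction r ¬r
... | no  _ = minimum-glb nonempty λ v∈ → let (s , s∈Γ) , _ , v≡ = ∈-map⁻ (cost L S A rec) v∈ in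
    subst (v ≤_) (sym v≡) (v≤ s s∈Γ)
  where
  nonempty : List.map (cost L S A rec) (elements (unguessed S)) ≢ []
  nonempty eq = contradiction
    (subst (cost L S A rec (s₀ , s₀∈Γ) ∈ˡ_) eq (∈-map⁺ (cost L S A rec) (∈-elements s₀∈Γ))) λ ()

W-guess : (L : Language n k) (S : Situation L) (A : Strategy) {s : Fin n} (s∈Γ : s ∈ unguessed S) →
  W L S A ≤ suc (W L (next (A L S s s∈Γ)) A)
W-guess L S A s∈Γ = W-acc-guess L S A s∈Γ (<-wellFounded _) (<-wellFounded _)

W-revealed : (L : Language n k) (S : Situation L) (A : Strategy) {w : Word n k} →
  w ∈ˡ words L → mask S ≡ reveal w → W L S A ≡ 0
W-revealed L S A w∈L eq = go (<-wellFounded _)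
  where
  go : (a : Acc _<_ ∣ unguessed S ∣) → W-acc L S A a ≡ 0
  go (acc rec) with revealed? L (mask S)
  ... | yes _ = refl
  ... | no ¬r = contradiction (subst (_∈ˡ List.map reveal (words L)) (sym eq) (∈-map⁺ reveal w∈L)) ¬r

-- The refusing setter, and the maximality of greedy answers.

stingy : SubsetOrder → Strategy
stingy order L S s s∈Γ with Optimal.possible? order {S = S} {s} ⊥
... | yes p = record { positions = ⊥ ; blank = λ j∈ → contradiction j∈ ∉⊥ ; possible′ = p }
-- Any legal answer would serve here: the lower bound relies on the refusals alone.
... | no  _ = GreedyCheater order L S s s∈Γ

stingy-refuses : (order : SubsetOrder) (L : Language n k) (S : Situation L) {s : Fin n} (s∈Γ : s ∈ unguessed S) →
  C L (mask S ⊕ s ^ ⊥) (unguessed S - s) ≢ [] → positions (stingy order L S s s∈Γ) ≡ ⊥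
stingy-refuses order L S {s} s∈Γ p with Optimal.possible? order {S = S} {s} ⊥
... | yes _ = refl
... | no ¬p = contradiction p ¬p

Greedy-max : (order : SubsetOrder) (L : Language n k) (S : Situation L) {s : Fin n} (s∈Γ : s ∈ unguessed S)
  {B : Subset k} → B ⊆ blanks (mask S) →
  length (C L (mask S ⊕ s ^ B) (unguessed S - s)) ≤
  length (C L (mask (next (GreedyCheater order L S s s∈Γ))) (unguessed S - s))
Greedy-max order L S {s} s∈Γ {B} B⊆ = proj₂
  (firstMax-spec (λ B → length (C L (mask S ⊕ s ^ B) (unguessed S - s)))
                 (head candidates) (tail candidates))
  (Equivalence.from (∈-subsets order (blanks (mask S)) B) B⊆)
  where
  candidates = subsets order (blanks (mask S))

lookup-ext : {X : Set} (xs ys : Vec X n) → (∀ j → lookup xs j ≡ lookup ys j) → xs ≡ ys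
lookup-ext xs ys eq = trans (sym (tabulate∘lookup xs)) (trans (tabulate-cong eq) (tabulate∘lookup ys))

W-three-guesses : (L : Language n k) (S : Situation L) (A : Strategy) {x y z : Fin n}
  (x∈ : x ∈ unguessed S) (y∈ : y ∈ unguessed S - x) (z∈ : z ∈ unguessed S - x - y) →
  let S₁ = next (A L S x x∈) ; S₂ = next (A L S₁ y y∈) ; S₃ = next (A L S₂ z z∈) in
  W L S A ≤ 3 + W L S₃ A
W-three-guesses L S A {x} {y} {z} x∈ y∈ z∈ =
  let S₁ = next (A L S x x∈) ; S₂ = next (A L S₁ y y∈) in
  ≤-trans (W-guess L S A x∈) (s≤s (≤-trans (W-guess L S₁ A y∈) (s≤s (W-guess L S₂ A z∈))))

-- The languages with `r` easy and `m` hard words.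

module Family (m r : ℕ) where

  a p q : Fin (3 + m)
  a = zero
  p = suc zero
  q = suc (suc zero)

  easy : Fin r → Word (3 + m) (suc r)
  easy i = a ∷ replicate r q [ i ]≔ p

  hard : Fin m → Word (3 + m) (suc r)
  hard x = replicate (suc r) (3 ↑ʳ x)

  lookup-easy : ∀ i j → lookup (replicate r q [ i ]≔ p) j ≡ p ⊎ lookup (replicate r q [ i ]≔ p) j ≡ q
  lookup-easy i j with j ≟ i
  ... | yes refl = inj₁ (lookup∘update i (replicate r q) p)
  ... | no  j≢i  = inj₂ (trans (lookup∘update′ j≢i (replicate r q) p) (lookup-replicate j q))

  easy-injective : ∀ {i j} → easy i ≡ easy j → i ≡ j
  easy-injective {i} {j} eq with i ≟ j
  ... | yes i≡j = i≡j
  ... | no  i≢j = contradiction (begin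
    p                                     ≡⟨ lookup∘update i (replicate r q) p ⟨
    lookup (easy i) (suc i)               ≡⟨ cong (λ w → lookup w (suc i)) eq ⟩
    lookup (easy j) (suc i)               ≡⟨ lookup∘update′ i≢j (replicate r q) p ⟩
    lookup (replicate r q) i              ≡⟨ lookup-replicate i q ⟩
    q                                     ∎) λ ()
    where open ≡-Reasoning

  hard-injective : ∀ {x y} → hard x ≡ hard y → x ≡ y
  hard-injective eq = suc-injective (suc-injective (suc-injective (cong (λ w → lookup w zero) eq)))

  L : Language (3 + m) (suc r)
  L .words  = List.tabulate easy ++ List.tabulate hard
  L .unique = Unique.++⁺ (Unique.tabulate⁺ easy-injective) (Unique.tabulate⁺ hard-injective)
    λ (w∈easy , w∈hard) → let i , w≡easy = ∈-tabulate⁻ w∈easy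
                              x , w≡hard = ∈-tabulate⁻ w∈hard in
      contradiction (cong (λ w → lookup w zero) (trans (sym w≡easy) w≡hard)) λ ()

  words⁻ : ∀ {w} → w ∈ˡ words L → (∃[ i ] w ≡ easy i) ⊎ (∃[ x ] w ≡ hard x)
  words⁻ w∈ = [ (λ w∈easy → inj₁ (∈-tabulate⁻ w∈easy)) , (λ w∈hard → inj₂ (∈-tabulate⁻ w∈hard)) ]′
    (∈-++⁻ (List.tabulate easy) w∈)

  unrevealed : Mask (3 + m) (suc r)
  unrevealed = replicate (suc r) nothing

  blank-≼ : (M : Mask (3 + m) k) → replicate k nothing ≼ M
  blank-≼ _ j = inj₁ (lookup-replicate j nothing)

  hard-consistent : ∀ {Γ x} → 3 ↑ʳ x ∈ Γ → Consistent unrevealed Γ (hard x)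
  hard-consistent {x = x} x∈Γ = blank-≼ (reveal (hard x)) , λ j _ →
    subst (_∈ _) (sym (lookup-replicate j (3 ↑ʳ x))) x∈Γ

  -- Only three letters are not hard, so four unguessed letters include a hard one.
  hardLetter : (Γ : Subset (3 + m)) → 3 < ∣ Γ ∣ → ∃[ x ] 3 ↑ʳ x ∈ Γ
  hardLetter Γ@(b₀ ∷ b₁ ∷ b₂ ∷ Γ′) 3<∣Γ∣ =
    let x , x∈Γ′ = 0<∣p∣⇒Nonempty Γ′ (ℕ.+-cancelˡ-< 3 0 ∣ Γ′ ∣ (ℕ.<-≤-trans 3<∣Γ∣ bound))
    in x , there (there (there x∈Γ′))
    where
    bound : ∣ Γ ∣ ≤ 3 + ∣ Γ′ ∣
    bound = ≤-trans (∣x∷p∣≤1+∣p∣ b₀ (b₁ ∷ b₂ ∷ Γ′)) (s≤s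
           (≤-trans (∣x∷p∣≤1+∣p∣ b₁ (b₂ ∷ Γ′)) (s≤s (∣x∷p∣≤1+∣p∣ b₂ Γ′))))

  -- While nothing is revealed, a hard word stays consistent as long as its only letter is
  -- unguessed.
  hard-possible : ∀ {M Γ} → M ≡ unrevealed → 3 < ∣ Γ ∣ → C L M Γ ≢ []
  hard-possible {Γ = Γ} refl 3<∣Γ∣ C≡[] =
    let x , x∈Γ = hardLetter Γ 3<∣Γ∣
        w∈C = ∈-filter⁺ (consistent? unrevealed Γ)
                (∈-++⁺ʳ (List.tabulate easy) (∈-tabulate⁺ x)) (hard-consistent x∈Γ)
    in contradiction (subst (hard x ∈ˡ_) C≡[] w∈C) λ ()

  ¬revealed : unrevealed ∉ˡ List.map reveal (words L)
  ¬revealed M∈ with ∈-map⁻ reveal M∈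
  -- Words have at least one position, where `reveal` gives `just` but the mask has `nothing`.
  ... | _ ∷ _ , _ , ()

  -- The lower bound from refusing.

  module _ (order : SubsetOrder) where

    -- Guesses of a, p, q and of the last hard letter need not fail, hence the 4.
    stingy-lower : (S : Situation L) → mask S ≡ unrevealed → (a : Acc _<_ ∣ unguessed S ∣) →
                   ∣ unguessed S ∣ ≤ 4 + W-acc L S (stingy order) a
    stingy-lower S M≡ (acc rec) = [ ℕ.m≤n⇒m≤n+o _ , many ]′ (ℕ.≤-<-connex ∣ unguessed S ∣ 4)
      where
      guess : 4 < ∣ unguessed S ∣ → ∀ s s∈Γ → let S′ = next (stingy order L S s s∈Γ) in
        ∣ unguessed S ∣ ≤ 4 + (W-acc L S′ (stingy order) (rec (x∈p⇒∣p-x∣<∣p∣ s∈Γ)) + failed (mask S) (mask S′))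
      guess 4<∣Γ∣ s s∈Γ = begin
        ∣ unguessed S ∣          ≤⟨ ∣p∣≤1+∣p-x∣ (unguessed S) s ⟩
        -- The guess uses up one letter and, being refused, adds one failure, so the induction
        -- hypothesis is shifted by one on both sides.
        suc ∣ unguessed S - s ∣  ≤⟨ s≤s (stingy-lower S′ (trans M′≡M M≡) (rec (x∈p⇒∣p-x∣<∣p∣ s∈Γ))) ⟩
        5 + w                    ≡⟨ cong (4 +_) (ℕ.+-comm 1 w) ⟩
        4 + (w + 1)              ≡⟨ cong (λ f → 4 + (w + f)) (failed-≡ M′≡M) ⟨
        4 + (w + failed (mask S) (mask S′)) ∎
        where
        open ℕ.≤-Reasoning
        S′ : Situation L
        S′ = next (stingy order L S s s∈Γ)
        possible⊥ : C L (mask S ⊕ s ^ ⊥) (unguessed S - s) ≢ []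
        -- More than 4 letters before the guess leave more than 3 after it, as `hardLetter` demands.
        possible⊥ = hard-possible (trans (⊕-^⊥ (mask S) s) M≡)
          (s≤s⁻¹ (≤-trans 4<∣Γ∣ (∣p∣≤1+∣p-x∣ (unguessed S) s)))
        M′≡M : mask S′ ≡ mask S
        M′≡M = trans (cong (λ B → mask S ⊕ s ^ B) (stingy-refuses order L S s∈Γ possible⊥)) (⊕-^⊥ (mask S) s)
        w = W-acc L S′ (stingy order) (rec (x∈p⇒∣p-x∣<∣p∣ s∈Γ))

      many : 4 < ∣ unguessed S ∣ → ∣ unguessed S ∣ ≤ 4 + W-acc L S (stingy order) (acc rec)
      -- `W-acc-glb` bounds `W-acc` alone, so the 4 is moved across by truncated subtraction.
      many 4<∣Γ∣ = ≤-trans (ℕ.m≤n+m∸n ∣ unguessed S ∣ 4) (ℕ.+-monoʳ-≤ 4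
        (W-acc-glb L S (stingy order) rec
          (λ M∈ → ¬revealed (subst (_∈ˡ List.map reveal (words L)) M≡ M∈))
          (0<∣p∣⇒Nonempty (unguessed S) (≤-trans (s≤s z≤n) 4<∣Γ∣))
          (λ s s∈Γ → ℕ.m≤n+o⇒m∸n≤o ∣ unguessed S ∣ 4 (guess 4<∣Γ∣ s s∈Γ))))

  -- The upper bound for `GreedyCheater`.

  module Greedy (order : SubsetOrder) (m<r : m < r) where

    easy-letters : ∀ i j → lookup (easy i) j ≡ a ⊎ lookup (easy i) j ≡ p ⊎ lookup (easy i) j ≡ q
    easy-letters i zero    = inj₁ refl
    easy-letters i (suc j) = inj₂ (lookup-easy i j)

    easy-consistent : ∀ {Γ} → p ∈ Γ → q ∈ Γ → ∀ i → Consistent (just a ∷ replicate r nothing) Γ (easy i)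
    easy-consistent {Γ} p∈Γ q∈Γ i =
      (λ { zero → inj₂ refl ; (suc j) → inj₁ (lookup-replicate j nothing) }) ,
      λ { zero () ; (suc j) _ →
            [ (λ eq → subst (_∈ Γ) (sym eq) p∈Γ) , (λ eq → subst (_∈ Γ) (sym eq) q∈Γ) ]′ (lookup-easy i j) }

    -- Once the initial `a` is revealed, an easy word needs only `p` and `q` unguessed, so all `r`
    -- of them survive.
    easy-kept : ∀ {M Γ} → M ≡ unrevealed → p ∈ Γ → q ∈ Γ → r ≤ length (C L (M ⊕ a ^ (inside ∷ ⊥)) Γ)
    easy-kept {Γ = Γ} refl p∈Γ q∈Γ = begin
      r                                                      ≡⟨ List.length-tabulate easy ⟨
      length (List.tabulate easy)                            ≡⟨ cong length (List.filter-all c? (All.tabulate⁺ consistent)) ⟨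
      length (filter c? (List.tabulate easy))                ≤⟨ ℕ.m≤m+n _ _ ⟩
      length (filter c? (List.tabulate easy)) + length (filter c? (List.tabulate hard))
        ≡⟨ List.length-++ (filter c? (List.tabulate easy)) ⟨
      length (filter c? (List.tabulate easy) ++ filter c? (List.tabulate hard))
        ≡⟨ cong length (List.filter-++ c? (List.tabulate easy) (List.tabulate hard)) ⟨
      length (C L M Γ)                                       ∎
      where
      open ℕ.≤-Reasoning
      M = unrevealed ⊕ a ^ (inside ∷ ⊥)
      c? = consistent? M Γ
      consistent : ∀ i → Consistent M Γ (easy i)
      consistent i = subst (λ N → Consistent (just a ∷ N) Γ (easy i)) (sym (⊕-^⊥ (replicate r nothing) a))
        (easy-consistent p∈Γ q∈Γ i)

    -- Every easy word begins with `a`, which is no longer available for the blank first position;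
    -- only hard words can remain.
    easy-dropped : ∀ {M Γ} → lookup M zero ≡ nothing → a ∉ Γ → length (C L M Γ) ≤ m
    easy-dropped {M} {Γ} M₀≡ a∉Γ = begin
      length (C L M Γ)
        ≡⟨ cong length (List.filter-++ (consistent? M Γ) (List.tabulate easy) (List.tabulate hard)) ⟩
      length (filter (consistent? M Γ) (List.tabulate easy) ++ filter (consistent? M Γ) (List.tabulate hard))
        ≡⟨ cong (λ ws → length (ws ++ filter (consistent? M Γ) (List.tabulate hard)))
             (List.filter-none (consistent? M Γ) (All.tabulate⁺ inconsistent)) ⟩
      length (filter (consistent? M Γ) (List.tabulate hard))
        ≤⟨ List.length-filter (consistent? M Γ) (List.tabulate hard) ⟩
      length (List.tabulate hard)
        ≡⟨ List.length-tabulate hard ⟩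
      m ∎
      where
      open ℕ.≤-Reasoning
      inconsistent : ∀ i → ¬ Consistent M Γ (easy i)
      inconsistent i (_ , w∈Γ) = a∉Γ (w∈Γ zero (nothing⇒blank M zero M₀≡))

    first-letter : ∀ {M} → M ≡ unrevealed → (B : Subset (suc r)) →
      lookup (M ⊕ a ^ B) zero ≡ just a ⊎ lookup (M ⊕ a ^ B) zero ≡ nothing
    first-letter refl (inside  ∷ _) = inj₁ refl
    first-letter refl (outside ∷ _) = inj₂ refl

    -- Some word is consistent, and by its first letter it is easy. All its letters have been
    -- guessed, so no position is blank and the mask is that word.
    easy-revealed : (S : Situation L) → lookup (mask S) zero ≡ just a →
      (∀ {x} → x ∈ unguessed S → ¬ (x ≡ a ⊎ x ≡ p ⊎ x ≡ q)) →
      ∃[ w ] w ∈ˡ words L × mask S ≡ reveal w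
    easy-revealed S M₀≡a ∉Γ with ≢[]⇒∃ (possible S)
    ... | w , w∈C with ∈-filter⁻ (consistent? (mask S) (unguessed S)) {xs = words L} w∈C
    ... | w∈L , M≼w , w∈Γ with words⁻ w∈L
    ... | inj₁ (i , refl) = easy i , w∈L , lookup-ext (mask S) (reveal (easy i)) λ j →
          [ (λ blank → contradiction (easy-letters i j) (∉Γ (w∈Γ j (nothing⇒blank (mask S) j blank)))) , id ]′ (M≼w j)
    ... | inj₂ (x , refl) = contradiction
          (trans (sym M₀≡a) ([ (λ eq → contradiction (trans (sym eq) M₀≡a) λ ()) , id ]′ (M≼w zero))) λ ()

    module _ (S : Situation L) (M≡ : mask S ≡ unrevealed)
             (a∈Γ : a ∈ unguessed S) (p∈Γ : p ∈ unguessed S) (q∈Γ : q ∈ unguessed S) where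

      private
        Γ : Subset (3 + m)
        Γ = unguessed S
        p∈ : p ∈ Γ - a
        p∈ = x∈p∧x≢y⇒x∈p-y {p = Γ} {y = a} p∈Γ λ ()
        q∈ : q ∈ Γ - a
        q∈ = x∈p∧x≢y⇒x∈p-y {p = Γ} {y = a} q∈Γ λ ()
        q∈′ : q ∈ Γ - a - p
        q∈′ = x∈p∧x≢y⇒x∈p-y {p = Γ - a} {y = p} q∈ λ ()

      -- A blank first position would leave at most `m` words, fewer than `r`.
      reveals-first : (x : Answer L S a) → r ≤ length (C L (mask (next x)) (Γ - a)) →
                      lookup (mask (next x)) zero ≡ just a
      reveals-first x r≤ = [ id , (λ eq → contradiction
          (≤-trans r≤ (easy-dropped {mask (next x)} {Γ - a} eq (x∉p-x Γ a))) (ℕ.<⇒≱ m<r)) ]′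
        (first-letter M≡ (positions x))

      B⊆blanks : inside ∷ ⊥ ⊆ blanks (mask S)
      B⊆blanks {j} _ = nothing⇒blank (mask S) j (trans (cong (λ M → lookup M j) M≡) (lookup-replicate j nothing))

      kept : r ≤ length (C L (mask S ⊕ a ^ (inside ∷ ⊥)) (Γ - a))
      kept = easy-kept {mask S} {Γ - a} M≡ p∈ q∈

      maximal : length (C L (mask S ⊕ a ^ (inside ∷ ⊥)) (Γ - a)) ≤
                length (C L (mask (next (GreedyCheater order L S a a∈Γ))) (Γ - a))
      maximal = Greedy-max order L S a∈Γ {inside ∷ ⊥} B⊆blanks

      -- Only the answer to `a` has to keep `r` words. However `p` and `q` are answered, all letters
      -- of easy words are then guessed and `easy-revealed` applies.
      three-guesses : (A : Strategy) → r ≤ length (C L (mask (next (A L S a a∈Γ))) (Γ - a)) → W L S A ≤ 3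
      three-guesses A r≤ = ≤-trans (W-three-guesses L S A a∈Γ p∈ q∈′)
        (ℕ.+-monoʳ-≤ 3 (≤-reflexive (W-revealed L S₃ A (proj₁ (proj₂ revealed)) (proj₂ (proj₂ revealed)))))
        where
        S₁ S₂ S₃ : Situation L
        S₁ = next (A L S a a∈Γ)
        S₂ = next (A L S₁ p p∈)
        S₃ = next (A L S₂ q q∈′)

        S₃-first : lookup (mask S₃) zero ≡ just a
        S₃-first = lookup-⊕-just (mask S₂) q (positions (A L S₂ q q∈′)) zero
          (lookup-⊕-just (mask S₁) p (positions (A L S₁ p p∈)) zero (reveals-first (A L S a a∈Γ) r≤))

        S₃-letters : ∀ {x} → x ∈ unguessed S₃ → ¬ (x ≡ a ⊎ x ≡ p ⊎ x ≡ q)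
        S₃-letters x∈ (inj₁ refl)        = x∉p-x Γ a (p─q⊆p (Γ - a) ⁅ p ⁆ (p─q⊆p (Γ - a - p) ⁅ q ⁆ x∈))
        S₃-letters x∈ (inj₂ (inj₁ refl)) = x∉p-x (Γ - a) p (p─q⊆p (Γ - a - p) ⁅ q ⁆ x∈)
        S₃-letters x∈ (inj₂ (inj₂ refl)) = x∉p-x (Γ - a - p) q x∈

        revealed : ∃[ w ] w ∈ˡ words L × mask S₃ ≡ reveal w
        revealed = easy-revealed S₃ S₃-first S₃-letters

      Greedy-upper : W L S (GreedyCheater order) ≤ 3
      Greedy-upper = three-guesses (GreedyCheater order) (≤-trans kept maximal)

  -- The gap between `GreedyCheater` and an optimal setter.

  start : 0 < m → Situation L
  start 0<m = situation unrevealed ⊤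
    (hard-possible refl (subst (3 <_) (sym (∣⊤∣≡n (3 + m))) (ℕ.+-monoʳ-< 3 0<m)))

  -- With all `3 + m` letters unguessed, `stingy-lower` and optimality give `3 + m ≤ 4 + W L S O`;
  -- cancelling 3 leaves the claim.
  optimal-lower : SubsetOrder → (O : Strategy) → IsOptimal L O → (S : Situation L) →
                  mask S ≡ unrevealed → unguessed S ≡ ⊤ → m ≤ 1 + W L S O
  optimal-lower order O optimal S M≡ Γ≡ = ℕ.+-cancelˡ-≤ 3 m (1 + W L S O)
    (≤-trans (≤-reflexive (sym (trans (cong ∣_∣ Γ≡) (∣⊤∣≡n (3 + m)))))
    (≤-trans (stingy-lower order S M≡ (<-wellFounded ∣ unguessed S ∣))
             (ℕ.+-monoʳ-≤ 4 (optimal S (stingy order)))))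

  greedy-vs-optimal : (order : SubsetOrder) → m < r → (S : Situation L) → mask S ≡ unrevealed → unguessed S ≡ ⊤ →
    W L S (GreedyCheater order) ≤ 3 × ((O : Strategy) → IsOptimal L O → m ≤ 1 + W L S O)
  greedy-vs-optimal order m<r S M≡ Γ≡ =
    Greedy.Greedy-upper order m<r S M≡ all all all , λ O optimal → optimal-lower order O optimal S M≡ Γ≡
    where
    all : ∀ {x} → x ∈ unguessed S
    all {x} = subst (x ∈_) (sym Γ≡) ∈⊤

Gap : SubsetOrder → ℕ → Set
Gap order m = ∃[ n ] ∃[ k ] ∃[ L ] ∃[ S ]
  W {n} {k} L S (GreedyCheater order) ≤ 3 × ((O : Strategy) → IsOptimal L O → m ≤ 1 + W L S O)

unbounded-gap : (order : SubsetOrder) (m : ℕ) → 0 < m → Gap order m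
unbounded-gap order m 0<m = _ , _ , L , start 0<m , greedy-vs-optimal order ≤-refl (start 0<m) refl refl
  where
  -- One more easy word than hard words is enough for `m < r`.
  open Family m (suc m)

-- Natural numbers among the rationals, and bounds on affine expressions.

infix 9 ι_

ι_ : ℕ → ℚ
ι m = ℤ.+ m ℚ./ 1

-- Division normalises by a gcd that is stuck on a variable `m`; the explicit fraction exposes
-- numerator and denominator.
ι≡mkℚ : ∀ m → ι m ≡ mkℚ (ℤ.+ m) 0 (coprime-sym (1-coprimeTo m))
ι≡mkℚ m = ℚ.fromℚᵘ-toℚᵘ (mkℚ (ℤ.+ m) 0 (coprime-sym (1-coprimeTo m)))

ι-+ : ∀ m n → ι m ℚ.+ ι n ≡ ι (m + n)
ι-+ m n rewrite ι≡mkℚ m | ι≡mkℚ n =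
  cong (ℚ._/ 1) (cong₂ ℤ._+_ (ℤ.*-identityʳ (ℤ.+ m)) (ℤ.*-identityʳ (ℤ.+ n)))

ι-* : ∀ m n → ι m ℚ.* ι n ≡ ι (m * n)
ι-* m n rewrite ι≡mkℚ m | ι≡mkℚ n = cong (ℚ._/ 1) (sym (ℤ.pos-* m n))

ι-mono : ∀ {m n} → m ≤ n → ι m ℚ.≤ ι n
ι-mono {m} {n} m≤n rewrite ι≡mkℚ m | ι≡mkℚ n = *≤* (ℤ.*-monoʳ-≤-nonNeg (ℤ.+ 1) (ℤ.+≤+ m≤n))

ι-cancel : ∀ {m n} → ι m ℚ.≤ ι n → m ≤ n
ι-cancel {m} {n} ιm≤ιn rewrite ι≡mkℚ m | ι≡mkℚ n =
  ℤ.drop‿+≤+ (ℤ.*-cancelʳ-≤-pos (ℤ.+ m) (ℤ.+ n) (ℤ.+ 1) (ℚ.drop-*≤* ιm≤ιn))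

-- Denominators are at least 1, so a nonnegative fraction is at most its numerator; a negative one
-- is below every natural number.
≤ι∣↥∣ : ∀ x → x ℚ.≤ ι ℤ.∣ ℚ.↥ x ∣
≤ι∣↥∣ x@(mkℚ (ℤ.+ m) d _) rewrite ι≡mkℚ m = *≤* (ℤ.*-monoˡ-≤-nonNeg (ℤ.+ m) (ℤ.+≤+ (s≤s z≤n)))
≤ι∣↥∣ x@(mkℚ ℤ.-[1+ m ] d _) rewrite ι≡mkℚ (suc m) = *≤* ℤ.-≤+

≤∣∣ : ∀ x → x ℚ.≤ ℚ.∣ x ∣
≤∣∣ (mkℚ (ℤ.+ m) d _)    = ℚ.≤-refl
≤∣∣ (mkℚ ℤ.-[1+ m ] d _) = *≤* ℤ.-≤+

-- From the Cauchy index `N` for 1 onwards, terms exceed `seq x N` by less than 1, and `≤ι∣↥∣`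
-- bounds `seq x N`.
eventually-≤ : (x : ℝ) → ∃[ K ] ∃[ N ] (∀ i → N ≤ i → seq x i ℚ.≤ ι K)
eventually-≤ x with cauchy x 1ℚ (ℚ.positive⁻¹ 1ℚ)
... | N , close = suc K , N , λ i N≤i → begin
  seq x i                        ≡⟨ ℚ.+-identityʳ (seq x i) ⟨
  seq x i ℚ.+ 0ℚ                 ≡⟨ cong (seq x i ℚ.+_) (ℚ.+-inverseˡ (seq x N)) ⟨
  seq x i ℚ.+ (ℚ.- seq x N ℚ.+ seq x N)  ≡⟨ ℚ.+-assoc (seq x i) (ℚ.- seq x N) (seq x N) ⟨
  (seq x i ℚ.- seq x N) ℚ.+ seq x N
    ≤⟨ ℚ.+-mono-≤ (ℚ.≤-trans (≤∣∣ _) (ℚ.<⇒≤ (close i N N≤i ≤-refl))) (≤ι∣↥∣ (seq x N)) ⟩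
  ι 1 ℚ.+ ι K                    ≡⟨ ι-+ 1 K ⟩
  ι (suc K)                      ∎
  where
  open ℚ.≤-Reasoning
  K = ℤ.∣ ℚ.↥ seq x N ∣

*ι-mono : ∀ {x K w B} → x ℚ.≤ ι K → w ≤ B → x ℚ.* ι w ℚ.≤ ι (K * B)
*ι-mono {x} {K} {w} {B} x≤K w≤B = begin
  x ℚ.* ι w     ≤⟨ ℚ.*-monoʳ-≤-nonNeg (ι w) {{ℚ.nonNegative (ι-mono {0} {w} z≤n)}} x≤K ⟩
  ι K ℚ.* ι w   ≡⟨ ι-* K w ⟩
  ι (K * w)     ≤⟨ ι-mono {K * w} {K * B} (ℕ.*-monoʳ-≤ K w≤B) ⟩
  ι (K * B)     ∎
  where
  open ℚ.≤-Reasoning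

affine-≤ : ∀ {x y z v m n} → ι v ℚ.≤ x ℚ.+ y ℚ.+ z → x ℚ.≤ ι m → y ℚ.≤ ι n → z ℚ.≤ ι 1 → v ≤ m + n + 1
affine-≤ {x} {y} {z} {v} {m} {n} v≤ x≤ y≤ z≤ = ι-cancel {v} {m + n + 1} (begin
  ι v                    ≤⟨ v≤ ⟩
  x ℚ.+ y ℚ.+ z          ≤⟨ ℚ.+-mono-≤ (ℚ.+-mono-≤ x≤ y≤) z≤ ⟩
  ι m ℚ.+ ι n ℚ.+ ι 1    ≡⟨ cong (ℚ._+ ι 1) (ι-+ m n) ⟩
  ι (m + n) ℚ.+ ι 1      ≡⟨ ι-+ (m + n) 1 ⟩
  ι (m + n + 1)          ∎)
  where
  open ℚ.≤-Reasoning

-- The bound `K` is chosen before `v` and `w`; this uniformity is what an unbounded gap contradicts.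
affine-bounded : (c b : ℝ) (B : ℕ) → ∃[ K ] (∀ v w → w ≤ B → fromℕ v ≤ᴿ c *ᴿ fromℕ w +ᴿ b → v ≤ K)
affine-bounded c b B =
  let Kc , Nc , c≤ = eventually-≤ c
      Kb , Nb , b≤ = eventually-≤ b
  in Kc * B + Kb + 1 , λ v w w≤B v≤ →
    -- Taking 1 for the tolerance in `_≤ᴿ_` accounts for the final `+ 1` in the bound; `i` lies
    -- beyond all three thresholds.
    let N , v≤ᵢ = v≤ 1ℚ (ℚ.positive⁻¹ 1ℚ)
        i = N ⊔ (Nc ⊔ Nb)
        Nc⊔Nb≤i = ℕ.m≤n⊔m N (Nc ⊔ Nb)
    in affine-≤ {x = seq c i ℚ.* ι w} {y = seq b i} {z = 1ℚ} {v = v} {m = Kc * B} {n = Kb}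
         (v≤ᵢ i (ℕ.m≤m⊔n N (Nc ⊔ Nb)))
         (*ι-mono {seq c i} {Kc} {w} {B} (c≤ i (≤-trans (ℕ.m≤m⊔n Nc Nb) Nc⊔Nb≤i)) w≤B)
         (b≤ i (≤-trans (ℕ.m≤n⊔m Nc Nb) Nc⊔Nb≤i))
         ℚ.≤-refl

-- Refutation of competitiveness.

Competitive : SubsetOrder → Set
Competitive order =
  ∃[ c ] ∃[ b ] 0ᴿ <ᴿ c ×
    (∀ {n k : ℕ} (L : Language n k) (OPT : Strategy) → IsOptimal L OPT → (S : Situation L) →
     fromℕ (W L S OPT) ≤ᴿ c *ᴿ fromℕ (W L S (GreedyCheater order)) +ᴿ b)

-- The competitive inequality concerns optimal strategies only, so it is applied to `opt`, whose
-- optimality is proved.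
unbounded⇒¬competitive : (order : SubsetOrder) → (∀ m → 0 < m → Gap order m) → ¬ Competitive order
unbounded⇒¬competitive order gap (c , b , _ , competitive) =
  let open Optimal order
      K , bounded = affine-bounded c b 3
      -- The choice `2 + K` turns the gap into `K < W L S opt`, against the bound `K`.
      _ , _ , L , S , W≤3 , 2+K≤1+W = gap (2 + K) (s≤s z≤n)
  in ℕ.<⇒≱ (s≤s⁻¹ (2+K≤1+W opt (opt-optimal L)))
       (bounded (W L S opt) (W L S (GreedyCheater order)) W≤3 (competitive L opt (opt-optimal L) S))

theorem1 : (order : SubsetOrder) →
    ¬ (∃[ c ] ∃[ b ] 0ᴿ <ᴿ c ×
    (∀ {n k : ℕ} (L : Language n k) (OPT : Strategy) → IsOptimal L OPT →
    (S : Situation L) →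
    fromℕ (W L S OPT) ≤ᴿ c *ᴿ fromℕ (W L S (GreedyCheater order)) +ᴿ b))
theorem1 order = unbounded⇒¬competitive order (unbounded-gap order)
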